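{- Let $G=(V,E)$ be the digraph with vertex set $V=\{s_1,u_1,v_1,u_2,v_2,u_3,v_3,a_1,a_2\}$ and the directed edges $$s_1\to u_2,\quad s_1\to v_1,\quad s_1\to v_2,\quad u_1\to u_2,\quad u_2\to u_1,\quad v_1\to u_3,\quad u_3\to v_1,\quad v_2\to v_3,\quad v_3\to v_2,$$ $$u_1\to v_1,\quad v_1\to v_2,\quad v_2\to a_1,\quad u_2\to u_3,\quad u_3\to v_3,\quad v_3\to a_2 .$$ Consider the deterministic graphical (DG) game on $G$ with initial position $s_1$ and three players $I=\{1,2,3\}$. Player 1 controls $V_1=\{s_1,u_1,v_1\}$, player 2 controls $V_2=\{u_2,v_2\}$, player 3 controls $V_3=\{u_3,v_3\}$, and the terminals are $V_T=\{a_1,a_2\}$. The game has exactly five outcomes: two terminal outcomes $a_1,a_2$, and three cyclic outcomes $c_1,c_2,c_3$ corresponding to the strongly connected components $\{u_1,u_2\}$, $\{v_1,u_3\}$, $\{v_2,v_3\}$, respectively. Let the preferences of the players over the outcomes be $$\text{player 1: } c_1 \prec_1 a_1 \prec_1 c_2 \prec_1 c_3 \prec_1 a_2,$$ $$\text{player 2: } a_2 \prec_2 c_1 \prec_2 c_2 \prec_2 a_1 \prec_2 c_3,$$ $$\text{player 3: } c_3 \prec_3 c_1 \prec_3 a_2 \prec_3 c_2 \prec_3 a_1 .$$ Then this game has no Nash equilibrium in pure stationary strategies, and its rank vector is $r=(r_1,r_2,r_3)=(1,2,1)$. Consequently, it is false that for every finite $n$-person DG game without Nash equilibria in pure stationary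 strategies at least two entries of the rank vector are at least $2$.
   Context: A finite $n$-person deterministic graphical (DG) game consists of the following data. (1) A finite digraph $G=(V,E)$, whose vertices are called positions and whose edges are called moves, with an initial position $v_0\in V\setminus V_T$ and a partition $V=V_1\cup\dots\cup V_n\cup V_T$. Here $V_T$ is the set of terminals (vertices with no outgoing edge) and $V_i$ is the set of positions controlled by player $i\in I=\{1,\dots,n\}$. By convention a loop is added at each terminal. (2) A set of outcomes $\Omega$. There is one outcome for each strongly connected component (SCC) of $G$ that contains a directed cycle (loops count as directed cycles, including the loops added at terminals). An SCC consisting of a single vertex without a loop is called transient and has no outcome. An outcome is called terminal if no edge leaves the corresponding SCC (for example, if the SCC is a terminal vertex with its loop); every other outcome is called cyclic (or inner). (3) For each player $i$, a strict linear order $\succ_i$ on $\Omega$, where $\omega\succ_i\omega'$ (equivalently $\omega'\prec_i\omega$) means that $i$ prefers $\omega$ to $\omega'$. A pure stationary strategy $x_i$ of player $i$ assigns to each position $v\in V_i$ one move $(v,v')\in E$ from $v$; let $X_i$ be the set of such strategies. A strategy profile $x=(x_1,\dots,x_n)\in X=X_1\times\dots\times X_n$ determines a unique walk (play) from $v_0$ which follows the chosen move in each position. Since the strategies are stationary, this play is an initial directed path (possibly empty) followed by a directed cycle repeated infinitely, where the cycle may be the loop at a terminal. The outcome $g(x)\in\Omega$ is the one corresponding to the SCC containing that cycle. A profile $x\in X$ is a Nash equilibrium (NE) in pure stationary strategies if there are no player $i\in I$ and profile $x'\in X$ with $x'_j=x_j$ for all $j\ne i$ such that $g(x')\succ_i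 g(x)$. The rank vector of the game is $r=(r_1,\dots,r_n)$, where $r_i$ is the number of terminal outcomes $a$ for which there exists a cyclic outcome $c$ with $c\succ_i a$. -}

module Defs where

open import Data.Empty using (⊥-elim)
open import Data.Fin using (Fin; zero; suc; toℕ; #_)
open import Data.Fin.Properties using (all?; pigeonhole)
import Data.Fin.Properties as Fin
open import Data.List using (List; []; _∷_)
open import Data.List.Membership.Propositional using (_∈_)
import Data.List.Membership.DecPropositional as DecMembership
open import Data.List.Relation.Unary.All using (All)
import Data.List.Relation.Unary.All as All
open import Data.Maybe using (Maybe; just; nothing)
open import Data.Nat using (ℕ; zero; suc; _<_; _≤_)
import Data.Nat as ℕ
import Data.Nat.Properties as ℕ
open import Data.Product using (Σ; ∃; ∃-syntax; _×_; _,_; proj₁; proj₂)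
open import Data.Product.Properties using (≡-dec)
open import Data.Sum using (_⊎_; inj₁; inj₂)
open import Data.Vec using (Vec; []; _∷_; lookup)
open import Function.Bundles using (Equivalence; Inverse; _⇔_; mk⇔)
open import Level using (0ℓ)
open import Relation.Binary using (Rel; Setoid; Decidable; IsEquivalence; IsStrictTotalOrder; Tri; tri<; tri≈; tri>)
open import Relation.Binary.Construct.Closure.ReflexiveTransitive using (Star; ε; _◅_; _◅◅_)
open import Relation.Binary.Construct.Closure.Transitive using (TransClosure; [_]; _∷_; _∷ʳ_)
import Relation.Binary.Construct.On as On
open import Relation.Binary.PropositionalEquality using (_≡_; _≢_; refl; sym; cong; subst; setoid)
open import Relation.Nullary using (¬_)
open import Relation.Nullary.Decidable using (True; toWitness; from-yes; ¬?; _⊎-dec_; _→-dec_)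
open import Relation.Unary using (Pred)

record Arena (n : ℕ) : Set₁ where
  field
    size : ℕ

  V : Set
  V = Fin size

  field
    Edge  : Rel V 0ℓ
    Edge? : Decidable Edge

  IsTerminal : Pred V 0ℓ
  IsTerminal v = ∀ w → ¬ Edge v w

  field
    -- The partition V = V₁ ∪ … ∪ Vₙ ∪ V_T: `just i` is Vᵢ, `nothing` is V_T.
    owner          : V → Maybe (Fin n)
    owner-terminal : ∀ v → owner v ≡ nothing ⇔ IsTerminal v
    v₀             : V
    v₀-nonterminal : ¬ IsTerminal v₀

  infix 4 _⟶_ _⟶*_ _⟶⁺_ _~_ _≈_

  -- The moves, with the conventional loop added at each terminal.
  _⟶_ : Rel V 0ℓ
  v ⟶ w = Edge v w ⊎ (v ≡ w × IsTerminal v)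

  _⟶*_ _⟶⁺_ : Rel V 0ℓ
  _⟶*_ = Star _⟶_
  _⟶⁺_ = TransClosure _⟶_

  _~_ : Rel V 0ℓ
  v ~ w = v ⟶* w × w ⟶* v

  ~-isEquivalence : IsEquivalence _~_
  ~-isEquivalence = record
    { refl  = ε , ε
    ; sym   = λ (p , q) → q , p
    ; trans = λ (p , q) (p′ , q′) → (p ◅◅ p′) , (q′ ◅◅ q)
    }

  -- An SCC is represented by any of its vertices.  The SCC of v contains a
  -- directed cycle exactly when there is a closed walk of positive length
  -- through v; this fails only if the SCC is a single vertex without a loop.
  record Outcome : Set where
    constructor outcome
    field
      vertex : V
      closed : vertex ⟶⁺ vertex
  open Outcome public

  _≈_ : Rel Outcome 0ℓ
  ω ≈ ω′ = vertex ω ~ vertex ω′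

  outcomeSetoid : Setoid 0ℓ 0ℓ
  outcomeSetoid = record
    { Carrier       = Outcome
    ; _≈_           = _≈_
    ; isEquivalence = On.isEquivalence vertex ~-isEquivalence
    }

  SCC : Outcome → Pred V 0ℓ
  SCC ω v = vertex ω ~ v

  TerminalOutcome : Pred Outcome 0ℓ
  TerminalOutcome ω = ∀ {v w} → SCC ω v → v ⟶ w → SCC ω w

  CyclicOutcome : Pred Outcome 0ℓ
  CyclicOutcome ω = ¬ TerminalOutcome ω

  Strategy : Fin n → Set
  Strategy i = ∀ v → owner v ≡ just i → ∃[ w ] Edge v w

  -- A move from v is determined by its end point.
  SameStrategy : ∀ {i} → Rel (Strategy i) 0ℓ
  SameStrategy {i} y z = ∀ v (o : owner v ≡ just i) → proj₁ (y v o) ≡ proj₁ (z v o)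

  Profile : Set
  Profile = ∀ i → Strategy i

  moveBy : Profile → ∀ v (o : Maybe (Fin n)) → owner v ≡ o → ∃[ w ] v ⟶ w
  moveBy x v (just i) o = let (w , e) = x i v o in w , inj₁ e
  moveBy x v nothing  o = v , inj₂ (refl , Equivalence.to (owner-terminal v) o)

  move : Profile → ∀ v → ∃[ w ] v ⟶ w
  move x v = moveBy x v (owner v) refl

  play : Profile → ℕ → V
  play x zero    = v₀
  play x (suc k) = proj₁ (move x (play x k))

  play-step : ∀ x k → play x k ⟶ play x (suc k)
  play-step x k = proj₂ (move x (play x k))

  play-walk : ∀ x {j k} → j ℕ.<′ k → play x j ⟶⁺ play x k
  play-walk x {j} (ℕ.<′-base)     = [ play-step x j ]
  play-walk x (ℕ.<′-step {k} j<k) = play-walk x j<k ∷ʳ play-step x k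

  -- Some position is visited at two different times j < k ≤ |V|; since
  -- strategies are stationary, it lies on the cycle that the play repeats.
  g : Profile → Outcome
  g x =
    let (j , k , j<k , eq) = pigeonhole (ℕ.n<1+n size) (λ t → play x (toℕ t))
    in outcome (play x (toℕ j))
               (subst (play x (toℕ j) ⟶⁺_) (sym eq) (play-walk x (ℕ.<⇒<′ j<k)))

record DGGame (n : ℕ) : Set₁ where
  field
    arena : Arena n

  open Arena arena public

  infix 4 _≻[_]_ _≺[_]_

  field
    -- ω ≻[ i ] ω′ : player i prefers ω to ω′.
    _≻[_]_               : Outcome → Fin n → Outcome → Set
    ≻-isStrictTotalOrder : ∀ i → IsStrictTotalOrder _≈_ (_≻[ i ]_)

  _≺[_]_ : Outcome → Fin n → Outcome → Set
  ω ≺[ i ] ω′ = ω′ ≻[ i ] ω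

  IsNE : Pred Profile 0ℓ
  IsNE x = ¬ (∃[ i ] ∃[ x′ ] (∀ j → j ≢ i → SameStrategy (x′ j) (x j)) × g x′ ≻[ i ] g x)

  HasNE : Set
  HasNE = ∃[ x ] IsNE x

  Counted : Fin n → Pred Outcome 0ℓ
  Counted i a = TerminalOutcome a × ∃[ c ] CyclicOutcome c × c ≻[ i ] a

  countedSetoid : Fin n → Setoid 0ℓ 0ℓ
  countedSetoid i = On.setoid {B = Σ Outcome (Counted i)} outcomeSetoid proj₁

  -- The i-th entry is the number of outcomes counted for i, up to _≈_.
  IsRankVector : Vec ℕ n → Set
  IsRankVector r = ∀ i → Inverse (setoid (Fin (lookup r i))) (countedSetoid i)

pattern s₁ = zero
pattern u₁ = suc zero
pattern v₁ = suc (suc zero)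
pattern u₂ = suc (suc (suc zero))
pattern v₂ = suc (suc (suc (suc zero)))
pattern u₃ = suc (suc (suc (suc (suc zero))))
pattern v₃ = suc (suc (suc (suc (suc (suc zero)))))
pattern a₁ = suc (suc (suc (suc (suc (suc (suc zero))))))
pattern a₂ = suc (suc (suc (suc (suc (suc (suc (suc zero)))))))

pattern player₁ = zero
pattern player₂ = suc zero
pattern player₃ = suc (suc zero)

edges : List (Fin 9 × Fin 9)
edges = (s₁ , u₂) ∷ (s₁ , v₁) ∷ (s₁ , v₂)
      ∷ (u₁ , u₂) ∷ (u₂ , u₁) ∷ (v₁ , u₃) ∷ (u₃ , v₁) ∷ (v₂ , v₃) ∷ (v₃ , v₂)
      ∷ (u₁ , v₁) ∷ (v₁ , v₂) ∷ (v₂ , a₁) ∷ (u₂ , u₃) ∷ (u₃ , v₃) ∷ (v₃ , a₂) ∷ []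

exEdge : Rel (Fin 9) 0ℓ
exEdge v w = (v , w) ∈ edges

exEdge? : Decidable exEdge
exEdge? v w = (v , w) ∈? edges
  where open DecMembership (≡-dec Fin._≟_ Fin._≟_) using (_∈?_)

exOwner : Fin 9 → Maybe (Fin 3)
exOwner s₁ = just player₁
exOwner u₁ = just player₁
exOwner v₁ = just player₁
exOwner u₂ = just player₂
exOwner v₂ = just player₂
exOwner u₃ = just player₃
exOwner v₃ = just player₃
exOwner a₁ = nothing
exOwner a₂ = nothing

a₁-terminal : ∀ w → ¬ exEdge a₁ w
a₁-terminal = from-yes (all? λ w → ¬? (exEdge? a₁ w))

a₂-terminal : ∀ w → ¬ exEdge a₂ w
a₂-terminal = from-yes (all? λ w → ¬? (exEdge? a₂ w))

toEdge : ∀ v w → {_ : True (exEdge? v w)} → exEdge v w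
toEdge v w {t} = toWitness t

exOwner-terminal : ∀ v → exOwner v ≡ nothing ⇔ (∀ w → ¬ exEdge v w)
exOwner-terminal s₁ = mk⇔ (λ ()) λ t → ⊥-elim (t u₂ (toEdge s₁ u₂))
exOwner-terminal u₁ = mk⇔ (λ ()) λ t → ⊥-elim (t u₂ (toEdge u₁ u₂))
exOwner-terminal v₁ = mk⇔ (λ ()) λ t → ⊥-elim (t u₃ (toEdge v₁ u₃))
exOwner-terminal u₂ = mk⇔ (λ ()) λ t → ⊥-elim (t u₁ (toEdge u₂ u₁))
exOwner-terminal v₂ = mk⇔ (λ ()) λ t → ⊥-elim (t v₃ (toEdge v₂ v₃))
exOwner-terminal u₃ = mk⇔ (λ ()) λ t → ⊥-elim (t v₁ (toEdge u₃ v₁))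
exOwner-terminal v₃ = mk⇔ (λ ()) λ t → ⊥-elim (t v₂ (toEdge v₃ v₂))
exOwner-terminal a₁ = mk⇔ (λ _ → a₁-terminal) (λ _ → refl)
exOwner-terminal a₂ = mk⇔ (λ _ → a₂-terminal) (λ _ → refl)

exArena : Arena 3
exArena = record
  { size           = 9
  ; Edge           = exEdge
  ; Edge?          = exEdge?
  ; owner          = exOwner
  ; owner-terminal = exOwner-terminal
  ; v₀             = s₁
  ; v₀-nonterminal = λ t → t u₂ (toEdge s₁ u₂)
  }

module Ex = Arena exArena

c₁ c₂ c₃ ⟨a₁⟩ ⟨a₂⟩ : Ex.Outcome
c₁   = Ex.outcome u₁ (inj₁ (toEdge u₁ u₂) ∷ [ inj₁ (toEdge u₂ u₁) ])
c₂   = Ex.outcome v₁ (inj₁ (toEdge v₁ u₃) ∷ [ inj₁ (toEdge u₃ v₁) ])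
c₃   = Ex.outcome v₂ (inj₁ (toEdge v₂ v₃) ∷ [ inj₁ (toEdge v₃ v₂) ])
⟨a₁⟩ = Ex.outcome a₁ [ inj₂ (refl , a₁-terminal) ]
⟨a₂⟩ = Ex.outcome a₂ [ inj₂ (refl , a₂-terminal) ]

-- A label for the SCC of each vertex, non-decreasing along edges.
component : Fin 9 → Fin 6
component s₁ = # 0
component u₁ = # 1
component u₂ = # 1
component v₁ = # 2
component u₃ = # 2
component v₂ = # 3
component v₃ = # 3
component a₁ = # 4
component a₂ = # 5

-- Utilities of the SCCs with labels 0, …, 5, that is, of the transient {s₁}
-- (a dummy value, since it carries no outcome), c₁, c₂, c₃, a₁, a₂.
utilities : Fin 3 → Vec ℕ 6
utilities player₁ = 0 ∷ 1 ∷ 3 ∷ 4 ∷ 2 ∷ 5 ∷ []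
utilities player₂ = 0 ∷ 2 ∷ 3 ∷ 5 ∷ 4 ∷ 1 ∷ []
utilities player₃ = 0 ∷ 2 ∷ 4 ∷ 1 ∷ 5 ∷ 3 ∷ []

utility : Fin 3 → Ex.Outcome → ℕ
utility i ω = lookup (utilities i) (component (Ex.vertex ω))

label : Fin 9 → ℕ
label v = toℕ (component v)

edge-mono : All (λ (v , w) → label v ≤ label w) edges
edge-mono = from-yes (All.all? (λ (v , w) → label v ℕ.≤? label w) edges)

⟶-mono : ∀ {v w} → v Ex.⟶ w → label v ≤ label w
⟶-mono (inj₁ e)          = All.lookup edge-mono e
⟶-mono (inj₂ (refl , _)) = ℕ.≤-refl

⟶*-mono : ∀ {v w} → v Ex.⟶* w → label v ≤ label w
⟶*-mono ε       = ℕ.≤-refl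
⟶*-mono (e ◅ p) = ℕ.≤-trans (⟶-mono e) (⟶*-mono p)

~⇒component : ∀ {v w} → v Ex.~ w → component v ≡ component w
~⇒component (p , q) = Fin.toℕ-injective (ℕ.≤-antisym (⟶*-mono p) (⟶*-mono q))

component-edge : ∀ v w → component v ≡ component w → v ≡ w ⊎ exEdge v w
component-edge = from-yes (all? λ v → all? λ w →
  (component v Fin.≟ component w) →-dec ((v Fin.≟ w) ⊎-dec exEdge? v w))

component⇒⟶* : ∀ v w → component v ≡ component w → v Ex.⟶* w
component⇒⟶* v w eq with component-edge v w eq
... | inj₁ refl = ε
... | inj₂ e    = inj₁ e ◅ ε

component⇒~ : ∀ v w → component v ≡ component w → v Ex.~ w
component⇒~ v w eq = component⇒⟶* v w eq , component⇒⟶* w v (sym eq)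

utilities-injective : ∀ i k l → lookup (utilities i) k ≡ lookup (utilities i) l → k ≡ l
utilities-injective = from-yes (all? λ i → all? λ k → all? λ l →
  (lookup (utilities i) k ℕ.≟ lookup (utilities i) l) →-dec (k Fin.≟ l))

≈⇒utility : ∀ i {ω ω′} → ω Ex.≈ ω′ → utility i ω ≡ utility i ω′
≈⇒utility i p = cong (lookup (utilities i)) (~⇒component p)

utility⇒≈ : ∀ i ω ω′ → utility i ω ≡ utility i ω′ → ω Ex.≈ ω′
utility⇒≈ i ω ω′ eq = component⇒~ _ _ (utilities-injective i _ _ eq)

prefers-isStrictTotalOrder : ∀ i → IsStrictTotalOrder Ex._≈_ (λ ω ω′ → utility i ω′ < utility i ω)
prefers-isStrictTotalOrder i = record
  { isStrictPartialOrder = record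
    { isEquivalence = Setoid.isEquivalence Ex.outcomeSetoid
    ; irrefl        = λ {ω} {ω′} p → ℕ.<-irrefl (sym (≈⇒utility i {ω} {ω′} p))
    ; trans         = λ p q → ℕ.<-trans q p
    ; <-resp-≈      =
        (λ {ω} {ω′} {ω″} p → subst (_< utility i ω) (≈⇒utility i {ω′} {ω″} p))
      , (λ {ω} {ω′} {ω″} p → subst (utility i ω <_) (≈⇒utility i {ω′} {ω″} p))
    }
  ; compare = compare
  }
  where
  compare : ∀ ω ω′ → Tri (utility i ω′ < utility i ω) (ω Ex.≈ ω′) (utility i ω < utility i ω′)
  compare ω ω′ with ℕ.<-cmp (utility i ω) (utility i ω′)
  ... | tri< a ¬b ¬c = tri> ¬c (λ p → ¬b (≈⇒utility i {ω} {ω′} p)) a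
  ... | tri≈ ¬a b ¬c = tri≈ ¬c (utility⇒≈ i ω ω′ b) ¬a
  ... | tri> ¬a ¬b c = tri< c (λ p → ¬b (≈⇒utility i {ω} {ω′} p)) ¬a

exGame : DGGame 3
exGame = record
  { arena                = exArena
  ; _≻[_]_               = λ ω i ω′ → utility i ω′ < utility i ω
  ; ≻-isStrictTotalOrder = prefers-isStrictTotalOrder
  }

module Example = DGGame exGame

{-# OPTIONS --safe #-}

-- Two finite reductions turn the absence of equilibria into a computation.
-- First, a stationary play has entered its final cycle by time |V|,
-- so the outcome is the SCC of the position at that time.  Second, the play
-- depends only on the end points of the chosen moves, and up to this there are
-- 12 · 4 · 4 profiles; each of them has an improving unilateral deviation.
module Submission where

open import Defs
open import Data.Empty using (⊥-elim)
open import Data.Fin using (Fin; zero; suc; toℕ)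
open import Data.Fin.Properties using (all?; any?; pigeonhole)
import Data.Fin.Properties as Fin
open import Data.List using (List; []; _∷_; allFin; cartesianProduct; cartesianProductWith; mapMaybe)
open import Data.List.Membership.Propositional using (_∈_)
import Data.List.Membership.DecPropositional as DecMembership
open import Data.List.Relation.Unary.All using (All)
import Data.List.Relation.Unary.All as All
open import Data.List.Relation.Unary.AllPairs using (allPairs?)
open import Data.List.Relation.Unary.Any using (Any)
import Data.List.Relation.Unary.Any as Any
import Data.List.Relation.Unary.Any.Properties as Any
open import Data.List.Relation.Unary.Linked using (Linked; linked?)
open import Data.List.Relation.Unary.Unique.Setoid using (Unique)
open import Data.List.Relation.Unary.Enumerates.Setoid using (IsEnumeration)
open import Data.Maybe using (Maybe; just; nothing)
open import Data.Nat using (ℕ; zero; suc; _≤_; _<_; _≤′_; ≤′-refl; ≤′-step; s≤s; _<?_; _≤?_)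
import Data.Nat.Properties as ℕ
open import Data.Product using (∃; ∃₂; ∃-syntax; _×_; _,_; proj₁)
open import Data.Sum using (_⊎_; inj₁; inj₂; [_,_]′)
open import Data.Vec using (Vec; []; _∷_; lookup)
open import Function.Base using (_∘_)
open import Function.Bundles using (Inverse)
open import Function.Properties.Bijection using (Bijection⇒Inverse)
open import Relation.Binary using (Decidable)
open import Relation.Binary.Construct.Closure.ReflexiveTransitive using (ε; _◅_; _◅◅_)
open import Relation.Binary.Construct.Closure.Transitive using ([_]; _∷_)
open import Relation.Binary.PropositionalEquality using (_≡_; _≢_; refl; sym; trans; cong; subst; subst₂; setoid)
open import Relation.Nullary using (¬_; Dec; yes; no)
open import Relation.Nullary.Decidable using (from-yes; from-no; map′; ¬?; _×-dec_; _⊎-dec_; _→-dec_)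
open import Relation.Unary using (_≐_)

-- Plays and unilateral deviations in an arbitrary arena.

module _ {n} (A : Arena n) where
  open Arena A

  update : Profile → ∀ i → Strategy i → Profile
  update x i y j with i Fin.≟ j
  ... | yes refl = y
  ... | no _     = x j

  update-same : ∀ x i y j → j ≢ i → SameStrategy (update x i y j) (x j)
  update-same x i y j j≢i v o with i Fin.≟ j
  ... | yes refl = ⊥-elim (j≢i refl)
  ... | no _     = refl

  update-cong : ∀ {x x′} i y → (∀ j → SameStrategy (x j) (x′ j)) →
                ∀ j → SameStrategy (update x i y j) (update x′ i y j)
  update-cong i y same j v o with i Fin.≟ j
  ... | yes refl = refl
  ... | no _     = same j v o

  play-cong : ∀ {x y} → (∀ i → SameStrategy (x i) (y i)) → ∀ k → play x k ≡ play y k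
  play-cong same zero    = refl
  play-cong {x} {y} same (suc k) =
    -- The profile is exchanged first, at the fixed position `play x k`; the position then follows
    -- by induction. `moveBy-cong` abstracts the owner so that it can be matched on.
    trans (moveBy-cong _ (owner (play x k)) refl) (cong (proj₁ ∘ move y) (play-cong same k))
    where
    moveBy-cong : ∀ v o (eq : owner v ≡ o) → proj₁ (moveBy x v o eq) ≡ proj₁ (moveBy y v o eq)
    moveBy-cong v (just i) eq = same i v eq
    moveBy-cong v nothing  eq = refl

  play-⟶* : ∀ x {j m} → j ≤′ m → play x j ⟶* play x m
  play-⟶* x ≤′-refl           = ε
  play-⟶* x (≤′-step {m} j≤m) = play-⟶* x j≤m ◅◅ (play-step x m ◅ ε)

  module _ (x : Profile) {j k} (j<k : j < k) (repeat : play x j ≡ play x k) where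

    -- By stationarity the next position is a function of the current one, so the representative
    -- time `i` advances along with `m` inside the window from `j` to `k`.
    play-periodic : ∀ {m} → j ≤′ m → ∃[ i ] j ≤ i × i < k × play x m ≡ play x i
    play-periodic ≤′-refl = j , ℕ.≤-refl , j<k , refl
    play-periodic (≤′-step j≤m) with play-periodic j≤m
    ... | i , j≤i , i<k , eq with ℕ.m≤n⇒m<n∨m≡n i<k
    ...   | inj₁ 1+i<k = suc i , ℕ.m≤n⇒m≤1+n j≤i , 1+i<k , cong (proj₁ ∘ move x) eq
    -- Here `suc i` is `k`: the window ends, and `repeat` leads back to time `j`.
    ...   | inj₂ refl  = j , ℕ.≤-refl , j<k , trans (cong (proj₁ ∘ move x) eq) (sym repeat)

    -- For the way back, the position at time `m` is also that of some time `i < k`, from which the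
    -- play walks on to time `k`, where it is again at `play x j`.
    play-~ : ∀ {m} → j ≤ m → play x j ~ play x m
    play-~ j≤m with play-periodic (ℕ.≤⇒≤′ j≤m)
    ... | i , j≤i , i<k , eq =
      play-⟶* x (ℕ.≤⇒≤′ j≤m) ,
      subst₂ _⟶*_ (sym eq) (sym repeat) (play-⟶* x (ℕ.≤⇒≤′ (ℕ.<⇒≤ i<k)))

  g-~ : ∀ x {m} → size ≤ m → vertex (g x) ~ play x m
  g-~ x size≤m =
    -- Repeating the pigeonhole call of `g` makes `vertex (g x)` compute to `play x (toℕ j)`. As `j`
    -- lies in `Fin (suc size)`, `toℕ j ≤ size ≤ m`.
    let (j , k , j<k , eq) = pigeonhole (ℕ.n<1+n size) (λ t → play x (toℕ t))
    in play-~ x j<k eq (ℕ.≤-trans (ℕ.≤-pred (Fin.toℕ<n j)) size≤m)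

open Example

-- Reachability in the example

-- Labels decide mutual reachability: they never decrease along moves, and vertices sharing a label
-- are equal or joined by edges both ways.
_~?_ : Decidable _~_
v ~? w = map′ (component⇒~ v w) ~⇒component (component v Fin.≟ component w)

_≈?_ : Decidable _≈_
ω ≈? ω′ = vertex ω ~? vertex ω′

_⟶?_ : Decidable _⟶_
v ⟶? w = Edge? v w ⊎-dec ((v Fin.≟ w) ×-dec all? (λ u → ¬? (Edge? v u)))

-- `TerminalOutcome` with explicit arguments and for a bare vertex, so that `all?` can decide it.
Closed : Fin 9 → Set
Closed v = ∀ w w′ → v ~ w → w ⟶ w′ → v ~ w′

closed? : ∀ v → Dec (Closed v)
closed? v = all? λ w → all? λ w′ → (v ~? w) →-dec ((w ⟶? w′) →-dec (v ~? w′))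

terminal? : ∀ ω → Dec (TerminalOutcome ω)
terminal? ω = map′ (λ f {v} {w} → f v w) (λ f v w → f {v} {w}) (closed? (vertex ω))

scc? : ∀ ω vs → Dec (SCC ω ≐ (_∈ vs))
scc? ω vs = map′ (λ (f , h) → (λ {v} → f v) , (λ {v} → h v)) (λ (f , h) → (λ v → f {v}) , (λ v → h {v}))
  (all? (λ v → (vertex ω ~? v) →-dec (v ∈? vs)) ×-dec all? (λ v → (v ∈? vs) →-dec (vertex ω ~? v)))
  where open DecMembership Fin._≟_ using (_∈?_)

prefers? : ∀ i → Decidable (_≺[ i ]_)
prefers? i ω ω′ = utility i ω <? utility i ω′

-- The last step would enter `s₁`, which has no incoming move. This discards the one vertex that
-- carries no outcome.
no-walk-to-s₁ : ∀ {v} → ¬ (v ⟶⁺ s₁)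
no-walk-to-s₁ [ e ]   = from-yes (all? λ v → ¬? (v ⟶? s₁)) _ e
no-walk-to-s₁ (_ ∷ p) = no-walk-to-s₁ p

outcomes : List Outcome
outcomes = ⟨a₁⟩ ∷ ⟨a₂⟩ ∷ c₁ ∷ c₂ ∷ c₃ ∷ []

outcome-or-s₁ : ∀ v → v ≡ s₁ ⊎ Any (λ ω → v ~ vertex ω) outcomes
outcome-or-s₁ = from-yes (all? λ v → (v Fin.≟ s₁) ⊎-dec Any.any? (λ ω → v ~? vertex ω) outcomes)

outcomes-enumerate : IsEnumeration outcomeSetoid outcomes
outcomes-enumerate (outcome v p) =
  [ (λ v≡s₁ → ⊥-elim (no-walk-to-s₁ (subst (v ⟶⁺_) v≡s₁ p))) , (λ v∈ → v∈) ]′ (outcome-or-s₁ v)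

-- Improving deviations

-- Time 9 is the number of vertices, so by `g-~` this position lies in the SCC of the outcome; the
-- pigeonhole search is never evaluated.
payoff : Fin 3 → Profile → ℕ
payoff i x = lookup (utilities i) (component (play x 9))

utility-g : ∀ i x → utility i (g x) ≡ payoff i x
utility-g i x = cong (lookup (utilities i)) (~⇒component (g-~ exArena x ℕ.≤-refl))

payoff-cong : ∀ i {x y} → (∀ j → SameStrategy (x j) (y j)) → payoff i x ≡ payoff i y
payoff-cong i same = cong (lookup (utilities i) ∘ component) (play-cong exArena same 9)

moves : ∀ v → List (∃ (Edge v))
moves v = mapMaybe target (allFin 9)
  where
  target : Fin 9 → Maybe (∃ (Edge v))
  target w with Edge? v w
  ... | yes e = just (w , e)
  ... | no _  = nothing

moves-complete : ∀ v (m : ∃ (Edge v)) → Any (λ m′ → proj₁ m ≡ proj₁ m′) (moves v)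
moves-complete v (w , e) =
  from-yes (all? λ v → all? λ w → Edge? v w →-dec Any.any? (λ m → w Fin.≟ proj₁ m) (moves v)) v w e

-- Dependent eliminator with two uses: for `P` a type of moves it builds strategies, for `P` an
-- equality of end points it proves `SameStrategy`.
owned₁ : (P : ∀ v → owner v ≡ just player₁ → Set) → P s₁ refl → P u₁ refl → P v₁ refl → ∀ v o → P v o
owned₁ P p q r s₁ refl = p
owned₁ P p q r u₁ refl = q
owned₁ P p q r v₁ refl = r
owned₁ P _ _ _ u₂ ()
owned₁ P _ _ _ v₂ ()
owned₁ P _ _ _ u₃ ()
owned₁ P _ _ _ v₃ ()
owned₁ P _ _ _ a₁ ()
owned₁ P _ _ _ a₂ ()

owned₂ : (P : ∀ v → owner v ≡ just player₂ → Set) → P u₂ refl → P v₂ refl → ∀ v o → P v o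
owned₂ P p q u₂ refl = p
owned₂ P p q v₂ refl = q
owned₂ P _ _ s₁ ()
owned₂ P _ _ u₁ ()
owned₂ P _ _ v₁ ()
owned₂ P _ _ u₃ ()
owned₂ P _ _ v₃ ()
owned₂ P _ _ a₁ ()
owned₂ P _ _ a₂ ()

owned₃ : (P : ∀ v → owner v ≡ just player₃ → Set) → P u₃ refl → P v₃ refl → ∀ v o → P v o
owned₃ P p q u₃ refl = p
owned₃ P p q v₃ refl = q
owned₃ P _ _ s₁ ()
owned₃ P _ _ u₁ ()
owned₃ P _ _ v₁ ()
owned₃ P _ _ u₂ ()
owned₃ P _ _ v₂ ()
owned₃ P _ _ a₁ ()
owned₃ P _ _ a₂ ()

-- Two of the three moves come paired because `cartesianProductWith` combines two lists.
strategy₁ : ∃ (Edge s₁) → ∃ (Edge u₁) × ∃ (Edge v₁) → Strategy player₁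
strategy₁ s (u , v) = owned₁ _ s u v

strategy₂ : ∃ (Edge u₂) → ∃ (Edge v₂) → Strategy player₂
strategy₂ = owned₂ _

strategy₃ : ∃ (Edge u₃) → ∃ (Edge v₃) → Strategy player₃
strategy₃ = owned₃ _

strategies : ∀ i → List (Strategy i)
strategies player₁ = cartesianProductWith strategy₁ (moves s₁) (cartesianProduct (moves u₁) (moves v₁))
strategies player₂ = cartesianProductWith strategy₂ (moves u₂) (moves v₂)
strategies player₃ = cartesianProductWith strategy₃ (moves u₃) (moves v₃)

strategies-complete : ∀ i (y : Strategy i) → Any (SameStrategy y) (strategies i)
strategies-complete player₁ y =
  Any.cartesianProductWith⁺ strategy₁
    (λ p (q , r) → owned₁ _ p q r)
    (moves-complete s₁ (y s₁ refl))
    (Any.cartesianProduct⁺ (moves-complete u₁ (y u₁ refl)) (moves-complete v₁ (y v₁ refl)))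
strategies-complete player₂ y =
  Any.cartesianProductWith⁺ strategy₂
    (owned₂ _)
    (moves-complete u₂ (y u₂ refl)) (moves-complete v₂ (y v₂ refl))
strategies-complete player₃ y =
  Any.cartesianProductWith⁺ strategy₃
    (owned₃ _)
    (moves-complete u₃ (y u₃ refl)) (moves-complete v₃ (y v₃ refl))

profile : Strategy player₁ → Strategy player₂ → Strategy player₃ → Profile
profile y₁ y₂ y₃ player₁ = y₁
profile y₁ y₂ y₃ player₂ = y₂
profile y₁ y₂ y₃ player₃ = y₃

-- Kept abstract in the lists: Agda would otherwise unfold the enumeration
-- of strategies when it compares types.
every-profile : (strats : ∀ i → List (Strategy i)) →
  (∀ i (y : Strategy i) → Any (SameStrategy y) (strats i)) →
  (P : Profile → Set) → (∀ {x y} → (∀ j → SameStrategy (x j) (y j)) → P y → P x) →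
  All (λ y₁ → All (λ y₂ → All (λ y₃ → P (profile y₁ y₂ y₃))
    (strats player₃)) (strats player₂)) (strats player₁) →
  ∀ x → P x
every-profile strats complete P resp all x =
  let all₁ , same₁ = All.lookupAny all (complete player₁ (x player₁))
      all₂ , same₂ = All.lookupAny all₁ (complete player₂ (x player₂))
      all₃ , same₃ = All.lookupAny all₂ (complete player₃ (x player₃))
  in resp (λ { player₁ → same₁ ; player₂ → same₂ ; player₃ → same₃ }) all₃

Improvable : Profile → Set
Improvable x = ∃[ i ] Any (λ z → payoff i x < payoff i (update exArena x i z)) (strategies i)

improvable? : ∀ x → Dec (Improvable x)
improvable? x = any? λ i → Any.any? (λ z → payoff i x <? payoff i (update exArena x i z)) (strategies i)

all-improvable :
  All (λ y₁ → All (λ y₂ → All (λ y₃ → Improvable (profile y₁ y₂ y₃))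
    (strategies player₃)) (strategies player₂)) (strategies player₁)
all-improvable = from-yes
  (All.all? (λ y₁ → All.all? (λ y₂ → All.all? (λ y₃ → improvable? (profile y₁ y₂ y₃))
    (strategies player₃)) (strategies player₂)) (strategies player₁))

-- The same replacement `z` improves both profiles, since they agree in end points before and after
-- the update.
improvable-resp : ∀ {x y} → (∀ j → SameStrategy (x j) (y j)) → Improvable y → Improvable x
improvable-resp same (i , dev) = i , Any.map
  (λ {z} → subst₂ _<_ (sym (payoff-cong i same)) (sym (payoff-cong i (update-cong exArena i z same))))
  dev

improvable : ∀ x → Improvable x
improvable = every-profile strategies strategies-complete Improvable improvable-resp all-improvable

improvable⇒¬NE : ∀ x → Improvable x → ¬ IsNE x
improvable⇒¬NE x (i , dev) ne =
  let z , gain = Any.satisfied dev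
      x′ = update exArena x i z
  in ne (i , x′ , update-same exArena x i z ,
         subst₂ _<_ (sym (utility-g i x)) (sym (utility-g i x′)) gain)

no-NE : ¬ HasNE
no-NE (x , ne) = improvable⇒¬NE x (improvable x) ne

-- The rank vector

utilities≤5 : ∀ i k → lookup (utilities i) k ≤ 5
utilities≤5 = from-yes (all? λ i → all? λ k → lookup (utilities i) k ≤? 5)

-- Utility 5 marks a player's favourite, to which nothing is preferred. This excludes `⟨a₂⟩` for
-- `player₁` and `⟨a₁⟩` for `player₃`.
counted⇒utility<5 : ∀ i {ω} → Counted i ω → utility i ω < 5
counted⇒utility<5 i (_ , c , _ , c≻ω) = ℕ.<-≤-trans c≻ω (utilities≤5 i (component (vertex c)))

⟨a₁⟩-terminal : TerminalOutcome ⟨a₁⟩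
⟨a₁⟩-terminal = from-yes (terminal? ⟨a₁⟩)

⟨a₂⟩-terminal : TerminalOutcome ⟨a₂⟩
⟨a₂⟩-terminal = from-yes (terminal? ⟨a₂⟩)

c₁-cyclic : CyclicOutcome c₁
c₁-cyclic = from-no (terminal? c₁)

c₂-cyclic : CyclicOutcome c₂
c₂-cyclic = from-no (terminal? c₂)

c₃-cyclic : CyclicOutcome c₃
c₃-cyclic = from-no (terminal? c₃)

-- `Counted` is relaxed to two conditions on a vertex, which leaves a check over nine vertices.
Covers : ∀ {m} → Fin 3 → Vec Outcome m → Set
Covers i ωs = ∀ v → Closed v → lookup (utilities i) (component v) < 5 → ∃[ k ] vertex (lookup ωs k) ~ v

covers? : ∀ {m} i (ωs : Vec Outcome m) → Dec (Covers i ωs)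
covers? i ωs = all? λ v → closed? v →-dec
  ((lookup (utilities i) (component v) <? 5) →-dec any? (λ k → vertex (lookup ωs k) ~? v))

Distinct : ∀ {m} → Vec Outcome m → Set
Distinct ωs = ∀ k l → lookup ωs k ≈ lookup ωs l → k ≡ l

distinct? : ∀ {m} (ωs : Vec Outcome m) → Dec (Distinct ωs)
distinct? ωs = all? λ k → all? λ l → (lookup ωs k ≈? lookup ωs l) →-dec (k Fin.≟ l)

-- Indexing into `ωs` is the bijection: `distinct` gives injectivity and `covers` surjectivity, as
-- `countedSetoid` compares only the underlying outcomes.
enumerate-counted : ∀ {m} i (ωs : Vec Outcome m) → (∀ k → Counted i (lookup ωs k)) →
                    Distinct ωs → Covers i ωs → Inverse (setoid (Fin m)) (countedSetoid i)
enumerate-counted i ωs counted distinct covers = Bijection⇒Inverse record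
  { to        = λ k → lookup ωs k , counted k
  ; cong      = λ { refl → ε , ε }
  ; bijective = distinct _ _ , λ (ω , counted-ω) →
      let k , ωₖ≈ω = covers (vertex ω) (λ v w → proj₁ counted-ω {v} {w}) (counted⇒utility<5 i {ω} counted-ω)
      in k , λ { refl → ωₖ≈ω }
  }

rank-vector : IsRankVector (1 ∷ 2 ∷ 1 ∷ [])
rank-vector player₁ = enumerate-counted player₁ ωs
  (λ { zero → ⟨a₁⟩-terminal , c₂ , c₂-cyclic , from-yes (prefers? player₁ ⟨a₁⟩ c₂) })
  (from-yes (distinct? ωs)) (from-yes (covers? player₁ ωs))
  where ωs = ⟨a₁⟩ ∷ []
rank-vector player₂ = enumerate-counted player₂ ωs
  -- `c₃` is the favourite of `player₂`, hence above both terminal outcomes.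
  (λ { zero       → ⟨a₁⟩-terminal , c₃ , c₃-cyclic , from-yes (prefers? player₂ ⟨a₁⟩ c₃)
     ; (suc zero) → ⟨a₂⟩-terminal , c₃ , c₃-cyclic , from-yes (prefers? player₂ ⟨a₂⟩ c₃) })
  (from-yes (distinct? ωs)) (from-yes (covers? player₂ ωs))
  where ωs = ⟨a₁⟩ ∷ ⟨a₂⟩ ∷ []
rank-vector player₃ = enumerate-counted player₃ ωs
  (λ { zero → ⟨a₂⟩-terminal , c₂ , c₂-cyclic , from-yes (prefers? player₃ ⟨a₂⟩ c₂) })
  (from-yes (distinct? ωs)) (from-yes (covers? player₃ ωs))
  where ωs = ⟨a₂⟩ ∷ []

-- Refutes the general claim: two distinct indices with entries at least 2 would both be `player₂`.
only-player₂-has-rank≥2 : ∀ i → 2 ≤ lookup (1 ∷ 2 ∷ 1 ∷ []) i → i ≡ player₂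
only-player₂-has-rank≥2 player₁ (s≤s ())
only-player₂-has-rank≥2 player₂ _ = refl
only-player₂-has-rank≥2 player₃ (s≤s ())

mainTheorem1 : let open Example
                   outcomes = ⟨a₁⟩ ∷ ⟨a₂⟩ ∷ c₁ ∷ c₂ ∷ c₃ ∷ []
    in
    -- the outcomes of the game
      (Unique outcomeSetoid outcomes × IsEnumeration outcomeSetoid outcomes)
    × (TerminalOutcome ⟨a₁⟩ × SCC ⟨a₁⟩ ≐ (_∈ (a₁ ∷ [])))
    × (TerminalOutcome ⟨a₂⟩ × SCC ⟨a₂⟩ ≐ (_∈ (a₂ ∷ [])))
    × (CyclicOutcome c₁ × SCC c₁ ≐ (_∈ (u₁ ∷ u₂ ∷ [])))
    × (CyclicOutcome c₂ × SCC c₂ ≐ (_∈ (v₁ ∷ u₃ ∷ [])))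
    × (CyclicOutcome c₃ × SCC c₃ ≐ (_∈ (v₂ ∷ v₃ ∷ [])))
    -- the preferences, from worst to best
    × Linked (_≺[ player₁ ]_) (c₁ ∷ ⟨a₁⟩ ∷ c₂ ∷ c₃ ∷ ⟨a₂⟩ ∷ [])
    × Linked (_≺[ player₂ ]_) (⟨a₂⟩ ∷ c₁ ∷ c₂ ∷ ⟨a₁⟩ ∷ c₃ ∷ [])
    × Linked (_≺[ player₃ ]_) (c₃ ∷ c₁ ∷ ⟨a₂⟩ ∷ c₂ ∷ ⟨a₁⟩ ∷ [])
    -- no Nash equilibrium, and the rank vector
    × ¬ HasNE
    × IsRankVector (1 ∷ 2 ∷ 1 ∷ [])
    -- the refuted claim about all DG games
    × ¬ (∀ {n} (Γ : DGGame n) (r : Vec ℕ n) →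
           ¬ DGGame.HasNE Γ → DGGame.IsRankVector Γ r →
           ∃₂ λ i j → i ≢ j × 2 ≤ lookup r i × 2 ≤ lookup r j)
mainTheorem1 =
    (from-yes (allPairs? (λ ω ω′ → ¬? (ω ≈? ω′)) outcomes) , outcomes-enumerate)
  , (⟨a₁⟩-terminal , from-yes (scc? ⟨a₁⟩ (a₁ ∷ [])))
  , (⟨a₂⟩-terminal , from-yes (scc? ⟨a₂⟩ (a₂ ∷ [])))
  , (c₁-cyclic , from-yes (scc? c₁ (u₁ ∷ u₂ ∷ [])))
  , (c₂-cyclic , from-yes (scc? c₂ (v₁ ∷ u₃ ∷ [])))
  , (c₃-cyclic , from-yes (scc? c₃ (v₂ ∷ v₃ ∷ [])))
  , from-yes (linked? (prefers? player₁) (c₁ ∷ ⟨a₁⟩ ∷ c₂ ∷ c₃ ∷ ⟨a₂⟩ ∷ []))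
  , from-yes (linked? (prefers? player₂) (⟨a₂⟩ ∷ c₁ ∷ c₂ ∷ ⟨a₁⟩ ∷ c₃ ∷ []))
  , from-yes (linked? (prefers? player₃) (c₃ ∷ c₁ ∷ ⟨a₂⟩ ∷ c₂ ∷ ⟨a₁⟩ ∷ []))
  , no-NE
  , rank-vector
  , λ claim →
      let i , j , i≢j , 2≤rᵢ , 2≤rⱼ = claim exGame (1 ∷ 2 ∷ 1 ∷ []) no-NE rank-vector
      in i≢j (trans (only-player₂-has-rank≥2 i 2≤rᵢ) (sym (only-player₂-has-rank≥2 j 2≤rⱼ)))
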